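{- Let $m$ be a positive integer. The set of P-positions of $m$-Modular Wythoff's Game is exactly $\mathcal{P}_{a_m}$.
   Context: Let $\phi = \frac{1+\sqrt5}{2}$. $m$-Modular Wythoff's Game ($m$ a positive integer): a position is an ordered pair $(p_1,p_2)$ of nonnegative integers, the numbers of tokens in two piles. Two players alternate moves. The allowed moves are: (Type I) take any positive number of tokens from exactly one pile; (Type II) take a positive number $k_1$ of tokens from the first pile and a positive number $k_2$ of tokens from the second pile, provided $k_1 \equiv k_2 \pmod m$. (Pile sizes must remain nonnegative.) The player who cannot move, i.e. whose turn it is at $(0,0)$, loses. A P-position is a position from which the previous player (the one who just moved) has a winning strategy; an N-position is one from which the next player to move has a winning strategy. Equivalently, since the game always terminates: a position is a P-position if and only if every move from it leads to an N-position, and a position is an N-position if and only if some move from it leads to a P-position. The sets $\mathcal{P}_i$ ($i \ge 0$) of ordered pairs of nonnegative integers are defined recursively by $\mathcal{P}_0 = \{(0,0)\}$ and, for $i \ge 1$, $\mathcal{P}_i = \mathcal{P}_{i-1} \cup \{(c_i, c_i+i), (c_i+i, c_i)\}$, where $c_i$ is the smallest positive integer that is not a coordinate of any ordered pair in $\mathcal{P}_{i-1}$. For a positive integer $m$, $a_m = \lfloor m/\phi \rfloor$; equivalently, $a_m$ is the unique integer with $\lfloor a_m \phi\rfloor < m \le \lfloor (a_m+1)\phi\rfloor$. -}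

module Defs where

open import Data.Integer as ℤ using (+_)
import Data.Integer.Properties as ℤₚ
open import Data.List using (List; []; _∷_; concatMap)
open import Data.List.Membership.DecPropositional using (_∈?_)
open import Data.List.Membership.Propositional using (_∈_; _∉_)
open import Data.List.Relation.Unary.Any using (here; there)
open import Data.Nat using (ℕ; zero; suc; _+_; _∸_; _≤_; _<_; _<?_; ∣_-_∣; z≤n; s≤s; z<s; s≤s⁻¹)
import Data.Nat.Properties as ℕₚ
open import Data.Nat.Divisibility using (_∣_)
open import Data.Nat.ListAction using (sum)
open import Data.Product using (_×_; _,_; proj₁; proj₂; ∃)
open import Data.Rational using (ℚ; 0ℚ; 1ℚ; ½; -½; _/_)
import Data.Rational as ℚ
import Data.Rational.Properties as ℚₚ
open import Data.Rational.Solver using (module +-*-Solver)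
open import Data.Rational.Unnormalised as ℚᵘ using (mkℚᵘ)
import Data.Rational.Unnormalised.Properties as ℚᵘₚ
open import Relation.Binary.PropositionalEquality
  using (_≡_; refl; sym; trans; cong; cong₂; subst)
open import Relation.Nullary using (¬_; Dec; yes; no)
open import Relation.Nullary.Decidable using (_×-dec_; ¬?; decidable-stable)
open import Relation.Unary using (Decidable)

Position : Set
Position = ℕ × ℕ

_≡_[mod_] : ℕ → ℕ → ℕ → Set
k ≡ l [mod m ] = m ∣ ∣ k - l ∣

data Move (m : ℕ) : Position → Position → Set where
  take₁    : ∀ {p q} k → 0 < k → k ≤ p → Move m (p , q) (p ∸ k , q)
  take₂    : ∀ {p q} k → 0 < k → k ≤ q → Move m (p , q) (p , q ∸ k)
  takeBoth : ∀ {p q} k₁ k₂ →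
             0 < k₁ → k₁ ≤ p → 0 < k₂ → k₂ ≤ q →
             k₁ ≡ k₂ [mod m ] →
             Move m (p , q) (p ∸ k₁ , q ∸ k₂)

-- The inhabitants are winning strategies: for the previous player in the case
-- of PPosition, for the next player in the case of NPosition.
mutual
  data PPosition (m : ℕ) (s : Position) : Set where
    allMovesToN : (∀ t → Move m s t → NPosition m t) → PPosition m s

  data NPosition (m : ℕ) (s : Position) : Set where
    someMoveToP : ∀ t → Move m s t → PPosition m t → NPosition m s

IsLeast : (ℕ → Set) → ℕ → Set
IsLeast P n = P n × (∀ k → k < n → ¬ P k)

least : {P : ℕ → Set} → Decidable P → ∀ b → P b → ∃ (IsLeast P)
least P? zero Pb = 0 , Pb , λ _ ()
least {P} P? (suc b) Pb with P? 0
... | yes P0 = 0 , P0 , λ _ ()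
... | no ¬P0 with n , Pn , min ← least (λ k → P? (suc k)) b Pb =
  suc n , Pn , min′
  where
  min′ : ∀ k → k < suc n → ¬ P k
  min′ zero    _   = ¬P0
  min′ (suc k) k<n = min k (s≤s⁻¹ k<n)

coordinates : List Position → List ℕ
coordinates = concatMap (λ (p , q) → p ∷ q ∷ [])

Fresh : List Position → ℕ → Set
Fresh ps n = 0 < n × n ∉ coordinates ps

∈⇒≤sum : ∀ {n} ns → n ∈ ns → n ≤ sum ns
∈⇒≤sum (n ∷ ns) (here refl)  = ℕₚ.m≤m+n n (sum ns)
∈⇒≤sum (n ∷ ns) (there n∈ns) = ℕₚ.≤-trans (∈⇒≤sum ns n∈ns) (ℕₚ.m≤n+m (sum ns) n)

leastFresh-exists : ∀ ps → ∃ (IsLeast (Fresh ps))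
leastFresh-exists ps =
  least (λ n → (0 <? n) ×-dec ¬? (_∈?_ ℕₚ._≟_ n (coordinates ps)))
        (suc (sum (coordinates ps)))
        (z<s , λ n∈ → ℕₚ.1+n≰n (∈⇒≤sum (coordinates ps) n∈))

leastFresh : List Position → ℕ
leastFresh ps = proj₁ (leastFresh-exists ps)

leastFresh-isLeast : ∀ ps → IsLeast (Fresh ps) (leastFresh ps)
leastFresh-isLeast ps = proj₂ (leastFresh-exists ps)

𝒫 : ℕ → List Position
𝒫 zero    = (0 , 0) ∷ []
𝒫 (suc i) = let c = leastFresh (𝒫 i) in
            (c , c + suc i) ∷ (c + suc i , c) ∷ 𝒫 i

-- The ordered field ℚ(√5), in which x +√5 y stands for the real number x + y√5.
infix 5 _+√5_
record ℚ√5 : Set where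
  constructor _+√5_
  field
    rat irr : ℚ

5ℚ : ℚ
5ℚ = + 5 / 1

infixl 7 _*√_
_*√_ : ℚ√5 → ℚ√5 → ℚ√5
(x +√5 y) *√ (u +√5 v) =
  (x ℚ.* u ℚ.+ 5ℚ ℚ.* (y ℚ.* v)) +√5 (x ℚ.* v ℚ.+ y ℚ.* u)

infixl 6 _-√_
_-√_ : ℚ√5 → ℚ√5 → ℚ√5
(x +√5 y) -√ (u +√5 v) = (x ℚ.- u) +√5 (y ℚ.- v)

-- As t ↦ t∣t∣ is odd and strictly increasing on the reals,
-- x ≥ - y√5 holds exactly when x∣x∣ ≥ - 5y∣y∣.
NonNeg√ : ℚ√5 → Set
NonNeg√ (x +√5 y) = 0ℚ ℚ.≤ x ℚ.* ℚ.∣ x ∣ ℚ.+ 5ℚ ℚ.* (y ℚ.* ℚ.∣ y ∣)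

infix 4 _≤√_ _<√_
_≤√_ _<√_ : ℚ√5 → ℚ√5 → Set
z ≤√ w = NonNeg√ (w -√ z)
z <√ w = ¬ (w ≤√ z)

_≤√?_ : ∀ z w → Dec (z ≤√ w)
(x +√5 y) ≤√? (u +√5 v) = 0ℚ ℚₚ.≤? _

fromℕ : ℕ → ℚ√5
fromℕ n = (+ n / 1) +√5 0ℚ

φ φ⁻¹ : ℚ√5
φ   = ½ +√5 ½
φ⁻¹ = -½ +√5 ½

φ*φ⁻¹≡1 : φ *√ φ⁻¹ ≡ fromℕ 1
φ*φ⁻¹≡1 = refl

_/φ : ℕ → ℚ√5
m /φ = fromℕ m *√ φ⁻¹

IsFloor : ℚ√5 → ℕ → Set
IsFloor z n = fromℕ n ≤√ z × z <√ fromℕ (suc n)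

floor-exists : ∀ z → fromℕ 0 ≤√ z → ∀ b → z <√ fromℕ (suc b) → ∃ (IsFloor z)
floor-exists z 0≤z b z<b
  with least (λ n → ¬? (fromℕ (suc n) ≤√? z)) b z<b
... | zero  , z<1 , _   = 0 , 0≤z , z<1
... | suc n , z<n , min =
  suc n , decidable-stable (fromℕ (suc n) ≤√? z) (min n ℕₚ.≤-refl) , z<n

private
  /1-mono-≤ : ∀ {m n} → m ≤ n → (+ m / 1) ℚ.≤ (+ n / 1)
  /1-mono-≤ {m} {n} m≤n = ℚₚ.toℚᵘ-cancel-≤
    (ℚᵘₚ.≤-respˡ-≃ (ℚᵘₚ.≃-sym (ℚₚ.toℚᵘ-fromℚᵘ (mkℚᵘ (+ m) 0)))
    (ℚᵘₚ.≤-respʳ-≃ (ℚᵘₚ.≃-sym (ℚₚ.toℚᵘ-fromℚᵘ (mkℚᵘ (+ n) 0)))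
    (ℚᵘ.*≤* (ℤₚ.*-monoʳ-≤-nonNeg (+ 1) (ℤ.+≤+ m≤n)))))

  *-nonNeg : ∀ {p q} → 0ℚ ℚ.≤ p → 0ℚ ℚ.≤ q → 0ℚ ℚ.≤ p ℚ.* q
  *-nonNeg {p} {q} 0≤p 0≤q = ℚₚ.nonNegative⁻¹ _
    {{ℚₚ.nonNeg*nonNeg⇒nonNeg p {{ℚ.nonNegative 0≤p}} q {{ℚ.nonNegative 0≤q}}}}

  +-nonNeg : ∀ {p q} → 0ℚ ℚ.≤ p → 0ℚ ℚ.≤ q → 0ℚ ℚ.≤ p ℚ.+ q
  +-nonNeg = ℚₚ.+-mono-≤

  ∣∣-neg : ∀ {p q} → p ≡ ℚ.- q → 0ℚ ℚ.≤ q → ℚ.∣ p ∣ ≡ q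
  ∣∣-neg {q = q} refl 0≤q = trans (ℚₚ.∣-p∣≡∣p∣ q) (ℚₚ.0≤p⇒∣p∣≡p 0≤q)

  ∣∣-pos : ∀ {p q} → p ≡ q → 0ℚ ℚ.≤ q → ℚ.∣ p ∣ ≡ q
  ∣∣-pos refl = ℚₚ.0≤p⇒∣p∣≡p

  square-form : ∀ {x y s t} → x ≡ ℚ.- s → y ≡ t → 0ℚ ℚ.≤ s → 0ℚ ℚ.≤ t →
                x ℚ.* ℚ.∣ x ∣ ℚ.+ 5ℚ ℚ.* (y ℚ.* ℚ.∣ y ∣) ≡
                (ℚ.- s) ℚ.* s ℚ.+ 5ℚ ℚ.* (t ℚ.* t)
  square-form x≡ y≡ 0≤s 0≤t =
    cong₂ (λ a b → a ℚ.+ 5ℚ ℚ.* b)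
          (cong₂ ℚ._*_ x≡ (∣∣-neg x≡ 0≤s)) (cong₂ ℚ._*_ y≡ (∣∣-pos y≡ 0≤t))

  open +-*-Solver using (solve; con; _:+_; _:*_; _:-_; :-_; _:=_)

  module _ (m : ℕ) where
    M N h : ℚ
    M = + m / 1
    N = + suc m / 1
    h = ½ ℚ.* M

    0≤M : 0ℚ ℚ.≤ M
    0≤M = /1-mono-≤ {0} {m} z≤n

    M≤N : M ℚ.≤ N
    M≤N = /1-mono-≤ (ℕₚ.n≤1+n m)

    0≤h : 0ℚ ℚ.≤ h
    0≤h = *-nonNeg {½} (ℚₚ.nonNegative⁻¹ ½) 0≤M

    0<N : 0ℚ ℚ.< N
    0<N = ℚₚ.<-≤-trans (ℚₚ.positive⁻¹ 1ℚ) (/1-mono-≤ {1} {suc m} (s≤s z≤n))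

    irr≡ : M ℚ.* ½ ℚ.+ 0ℚ ℚ.* -½ ℚ.- 0ℚ ≡ h
    irr≡ = solve 1 (λ x → x :* con ½ :+ con 0ℚ :* con -½ :- con 0ℚ
                          := con ½ :* x) refl M

    0≤m/φ : fromℕ 0 ≤√ (m /φ)
    0≤m/φ = subst (0ℚ ℚ.≤_) (sym (trans (square-form rat≡ irr≡ 0≤h 0≤h) expand))
                  (*-nonNeg {+ 4 / 1} (ℚₚ.nonNegative⁻¹ (+ 4 / 1)) (*-nonNeg 0≤h 0≤h))
      where
      rat≡ : M ℚ.* -½ ℚ.+ 5ℚ ℚ.* (0ℚ ℚ.* ½) ℚ.- 0ℚ ≡ ℚ.- h
      rat≡ = solve 1 (λ x → x :* con -½ :+ con 5ℚ :* (con 0ℚ :* con ½) :- con 0ℚ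
                            := :- (con ½ :* x)) refl M
      expand : (ℚ.- h) ℚ.* h ℚ.+ 5ℚ ℚ.* (h ℚ.* h) ≡ (+ 4 / 1) ℚ.* (h ℚ.* h)
      expand = solve 1 (λ x → (:- x) :* x :+ con 5ℚ :* (x :* x)
                            := con (+ 4 / 1) :* (x :* x)) refl h

    m/φ<1+m : (m /φ) <√ fromℕ (suc m)
    m/φ<1+m 0≤ = ℚₚ.<-irrefl refl (ℚₚ.<-≤-trans (ℚₚ.neg-antimono-< 0<R) 0≤-R)
      where
      d R : ℚ
      d = N ℚ.- M
      R = N ℚ.* N ℚ.+ (h ℚ.* d ℚ.+ h ℚ.* d)
      0≤d : 0ℚ ℚ.≤ d
      0≤d = subst (ℚ._≤ d) (ℚₚ.+-inverseʳ M) (ℚₚ.+-monoˡ-≤ (ℚ.- M) M≤N)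
      0<R : 0ℚ ℚ.< R
      0<R = ℚₚ.+-mono-<-≤
        (ℚₚ.positive⁻¹ (N ℚ.* N)
          {{ℚₚ.pos*pos⇒pos N {{ℚ.positive 0<N}} N {{ℚ.positive 0<N}}}})
        (+-nonNeg (*-nonNeg 0≤h 0≤d) (*-nonNeg 0≤h 0≤d))
      rat≡ : M ℚ.* -½ ℚ.+ 5ℚ ℚ.* (0ℚ ℚ.* ½) ℚ.- N ≡ ℚ.- (h ℚ.+ N)
      rat≡ = solve 2 (λ x n → x :* con -½ :+ con 5ℚ :* (con 0ℚ :* con ½) :- n
                              := :- (con ½ :* x :+ n)) refl M N
      -- (h + N)² - 5h² = N² + 2h(N - 2h), and M = 2h
      expand : (ℚ.- (h ℚ.+ N)) ℚ.* (h ℚ.+ N) ℚ.+ 5ℚ ℚ.* (h ℚ.* h) ≡ ℚ.- R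
      expand = solve 2 (λ x n →
        (:- (con ½ :* x :+ n)) :* (con ½ :* x :+ n)
          :+ con 5ℚ :* ((con ½ :* x) :* (con ½ :* x))
        := :- (n :* n :+ ((con ½ :* x) :* (n :- x) :+ (con ½ :* x) :* (n :- x))))
        refl M N
      0≤h+N : 0ℚ ℚ.≤ h ℚ.+ N
      0≤h+N = +-nonNeg 0≤h (ℚₚ.<⇒≤ 0<N)
      0≤-R : 0ℚ ℚ.≤ ℚ.- R
      0≤-R = subst (0ℚ ℚ.≤_) (trans (square-form rat≡ irr≡ 0≤h+N 0≤h) expand) 0≤

floor[_/φ] : ∀ m → ∃ (IsFloor (m /φ))
floor[ m /φ] = floor-exists (m /φ) (0≤m/φ m) m (m/φ<1+m m)

a : ℕ → ℕ
a m = proj₁ floor[ m /φ]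

a-isFloor : ∀ m → IsFloor (m /φ) (a m)
a-isFloor m = proj₂ floor[ m /φ]

{-# OPTIONS --safe #-}

-- The set 𝒫 consists of the pairs {c i , c i + i}, and c i = ⌊iφ⌋ because, by
-- Beatty's theorem, the sequences ⌊iφ⌋ and ⌊iφ⌋ + i = ⌊iφ²⌋ partition the
-- positive integers.  Write A for ⌊m/φ⌋, so that c A < m ≤ c (A + 1) and
-- c j + j < m exactly when j + A < m.  A type II move inside 𝒫 A would need
-- i - j or i + j to be a multiple of m; the former lies strictly between 0 and
-- m, and in the latter case c j + j < c i < m, so i + j < m.  From a position
-- outside 𝒫 A whose smaller entry is a coordinate of 𝒫 A one moves as in
-- Wythoff's game.  Otherwise both entries are at least m, and their difference
-- d has a residue r mod m: the target has difference r if r ≤ A, and m - r in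
-- the opposite order if r > A.
module Submission where

open import Defs
open import Data.Integer as ℤ using (+_)
import Data.Integer.Properties as ℤₚ
open import Data.List using ([]; _∷_)
open import Data.List.Membership.Propositional using (_∈_; _∉_)
open import Data.List.Relation.Unary.Any using (here; there)
open import Data.Nat
open import Data.Nat.Divisibility using (_∣_; divides; >⇒∤; _∣0)
open import Data.Nat.DivMod using (_/_; _%_; m≡m%n+[m/n]*n; m%n<n; m%n≤m)
open import Data.Nat.Induction using (<-wellFounded; Acc; acc)
open import Data.Nat.Properties
open import Data.Nat.Tactic.RingSolver using (solve-∀)
open import Data.Product using (_×_; _,_; proj₁; proj₂; ∃; swap)
open import Data.Rational as ℚ using (ℚ; 0ℚ; ½; -½)
import Data.Rational.Properties as ℚₚ
open import Data.Rational.Solver using (module +-*-Solver)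
open import Data.Rational.Unnormalised as ℚᵘ using (mkℚᵘ)
import Data.Rational.Unnormalised.Properties as ℚᵘₚ
open import Data.Sum using (_⊎_; inj₁; inj₂)
open import Relation.Binary.Definitions using (tri<; tri≈; tri>)
open import Relation.Binary.PropositionalEquality
open import Relation.Nullary using (¬_; Dec; yes; no; contradiction)
open import Relation.Unary using (_≐_)

-- Comparison of naturals with multiples of φ

infix 4 _<φ·_ _>φ·_

-- x <φ· y and x >φ· y compare x with φy: the sign of x² - xy - y² is that of
-- x - φy, the other root being negative.
_<φ·_ _>φ·_ : ℕ → ℕ → Set
x <φ· y = x * x < y * y + x * y
x >φ· y = y * y + x * y < x * x

_>φ·?_ : ∀ x y → Dec (x >φ· y)
x >φ·? y = y * y + x * y <? x * x

-- x² = xy + y² with x = y + z gives y² = yz + z².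
φ-irrational : ∀ x y → x * x ≡ y * y + x * y → x ≡ 0
φ-irrational x y = descend x x y ≤-refl
  where
  open ≡-Reasoning
  descend : ∀ b x y → x ≤ b → x * x ≡ y * y + x * y → x ≡ 0
  descend b zero y _ _ = refl
  descend (suc b) x@(suc _) y x≤b eq with <-cmp x y
  ... | tri< x<y _ _ = contradiction eq
        (<⇒≢ (<-≤-trans (*-mono-< x<y x<y) (m≤m+n (y * y) (x * y))))
  ... | tri≈ _ refl _ = contradiction eq (<⇒≢ (m<m+n (x * x) z<s))
  ... | tri> _ _ y<x with m≤n⇒∃[o]m+o≡n (<⇒≤ y<x)
  ... | z , y+z≡x = contradiction (subst (λ y → x * x ≡ y * y + x * y) y≡0 eq) x²≢
    where
    left : ∀ y z → (y + z) * (y + z) ≡ (y * y + y * z) + (z * z + y * z)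
    left = solve-∀
    right : ∀ y z → (y * y + y * z) + y * y ≡ y * y + (y + z) * y
    right = solve-∀
    eq′ : y * y ≡ z * z + y * z
    eq′ = +-cancelˡ-≡ (y * y + y * z) _ _ (begin
      (y * y + y * z) + y * y             ≡⟨ right y z ⟩
      y * y + (y + z) * y                 ≡⟨ cong (λ x → y * y + x * y) y+z≡x ⟩
      y * y + x * y                       ≡⟨ eq ⟨
      x * x                               ≡⟨ cong (λ x → x * x) y+z≡x ⟨
      (y + z) * (y + z)                   ≡⟨ left y z ⟩
      (y * y + y * z) + (z * z + y * z)   ∎)
    y≡0 : y ≡ 0
    y≡0 = descend b y z (s≤s⁻¹ (≤-trans y<x x≤b)) eq′
    x²≢ : x * x ≢ 0 * 0 + x * 0
    x²≢ e = contradiction (trans e (*-zeroʳ x)) λ ()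

φ-dichotomy : ∀ x y → 0 < x → x <φ· y ⊎ x >φ· y
φ-dichotomy x y 0<x with <-cmp (x * x) (y * y + x * y)
... | tri< lt _ _ = inj₁ lt
... | tri≈ _ eq _ = contradiction (φ-irrational x y eq) (>⇒≢ 0<x)
... | tri> _ _ gt = inj₂ gt

-- The flips below express φ = 1 + φ⁻¹: x + y < φx exactly when x > φy.
module _ {x y : ℕ} where
  private
    square : ∀ x y → (x + y) * (x + y) ≡ (x * x + x * y) + (y * y + x * y)
    square = solve-∀
    mixed : ∀ x y → x * x + (x + y) * x ≡ (x * x + x * y) + x * x
    mixed = solve-∀

  flip-> : x >φ· y → x + y <φ· x
  flip-> gt = subst₂ _<_ (sym (square x y)) (sym (mixed x y))
                (+-monoʳ-< (x * x + x * y) gt)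

  flip-< : x <φ· y → x + y >φ· x
  flip-< lt = subst₂ _<_ (sym (mixed x y)) (sym (square x y))
                (+-monoʳ-< (x * x + x * y) lt)

  unflip-< : x + y <φ· x → x >φ· y
  unflip-< lt = +-cancelˡ-< (x * x + x * y) _ _
                  (subst₂ _<_ (square x y) (mixed x y) lt)

  unflip-> : x + y >φ· x → x <φ· y
  unflip-> gt = +-cancelˡ-< (x * x + x * y) _ _
                  (subst₂ _<_ (mixed x y) (square x y) gt)

module _ (x : ℕ) {i j : ℕ} (i≤j : i ≤ j) where
  private
    mono : i * i + x * i ≤ j * j + x * j
    mono = +-mono-≤ (*-mono-≤ i≤j i≤j) (*-monoʳ-≤ x i≤j)

  <φ·-monoʳ : x <φ· i → x <φ· j
  <φ·-monoʳ lt = <-≤-trans lt mono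

  >φ·-antiʳ : x >φ· j → x >φ· i
  >φ·-antiʳ gt = ≤-<-trans mono gt

φ·-between : ∀ x {i j} → x >φ· i → ¬ x >φ· j → i < j
φ·-between x gt ¬gt = ≰⇒> λ j≤i → ¬gt (>φ·-antiʳ x j≤i gt)

>φ·⇒> : ∀ {x y} → x >φ· y → x > y
>φ·⇒> {x} {y} gt = ≰⇒> λ x≤y →
  <⇒≱ gt (≤-trans (*-monoʳ-≤ x x≤y) (m≤n+m (x * y) (y * y)))

-- `x` occurs on both sides of the inequality. Flipping moves its excess `e` over `y` to the right
-- of `_<φ·_`, where monotonicity is termwise.
>φ·-monoˡ : ∀ {x x′ y} → x ≤ x′ → x >φ· y → x′ >φ· y
>φ·-monoˡ {x} {x′} {y} x≤x′ gt
  with e , refl ← m≤n⇒∃[o]m+o≡n (<⇒≤ (>φ·⇒> {x} {y} gt))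
  with e′ , refl ← m≤n⇒∃[o]m+o≡n (≤-trans (m≤m+n y e) x≤x′) =
  flip-< {y} {e′} (<φ·-monoʳ y (+-cancelˡ-≤ y e e′ x≤x′) (unflip-> {y} {e} gt))

<φ·-pred : ∀ {x y} → suc x <φ· y → x <φ· y
<φ·-pred {zero} {zero} ()
<φ·-pred {zero} {suc y} _ = z<s
<φ·-pred {x@(suc _)} {y} lt with φ-dichotomy x y z<s
... | inj₁ lt′ = lt′
... | inj₂ gt = contradiction (>φ·-monoˡ {y = y} (n≤1+n x) gt) (<-asym lt)

-- This holds because φ > 1: the bound φy drops by more than `x` does. After the flip the difference
-- `e` stays fixed and only the left side drops.
>φ·-pred : ∀ {x y} → suc x >φ· suc y → x >φ· y
>φ·-pred {x} {y} gt
  with e , refl ← m≤n⇒∃[o]m+o≡n (s≤s⁻¹ (<⇒≤ (>φ·⇒> {suc x} {suc y} gt))) =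
  flip-< {y} {e} (<φ·-pred {y} {e} (unflip-> {suc y} {e} gt))

-- Floors of multiples of φ, and Beatty's theorem

-- n = ⌊jφ⌋
record IsFloorφ (n j : ℕ) : Set where
  constructor _,_
  field
    below : ¬ n >φ· j
    above : suc n >φ· j

floorφ-exists : ∀ j → ∃ λ n → IsFloorφ n j
-- φ < 2 makes `2 * j` an upper bound for the search.
floorφ-exists j with least (λ n → suc n >φ·? j) (2 * j) bound
  where
  expand : ∀ j → suc (2 * j) * suc (2 * j) ≡
                 suc (j * j + suc (2 * j) * j) + (j * j + 3 * j)
  expand = solve-∀
  bound : suc (2 * j) >φ· j
  bound = subst (j * j + suc (2 * j) * j <_) (sym (expand j)) (s≤s (m≤m+n _ _))
... | zero  , gt , _   = 0 , (λ ()) , gt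
... | suc n , gt , min = suc n , min n ≤-refl , gt

floorφ-cancel-< : ∀ {n n′ i j} → IsFloorφ n i → IsFloorφ n′ j → n < n′ → i < j
floorφ-cancel-< {n′ = n′} {i} (_ , gt) (¬gt , _) n<n′ =
  φ·-between n′ (>φ·-monoˡ {y = i} n<n′ gt) ¬gt

-- Consecutive multiples of φ are more than 1 apart: if `n′ ≤ n`, then `suc n′ >φ· suc i`, and
-- lowering both by 1 gives `n >φ· i`.
floorφ-mono-< : ∀ {n n′ i j} → IsFloorφ n i → IsFloorφ n′ j → i < j → n < n′
floorφ-mono-< {n} {n′} {i} {j} (¬gt , _) (_ , gt) i<j = ≰⇒> λ n′≤n →
  ¬gt (>φ·-monoˡ {y = i} n′≤n (>φ·-pred {n′} {i} (>φ·-antiʳ (suc n′) i<j gt)))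

floorφ-unique : ∀ {n n′ j} → IsFloorφ n j → IsFloorφ n′ j → n ≡ n′
floorφ-unique {n} {n′} f f′ with <-cmp n n′
... | tri< lt _ _ = contradiction (floorφ-cancel-< f f′ lt) (<-irrefl refl)
... | tri≈ _ eq _ = eq
... | tri> _ _ gt = contradiction (floorφ-cancel-< f′ f gt) (<-irrefl refl)

floorφ-injective : ∀ {n i j} → IsFloorφ n i → IsFloorφ n j → i ≡ j
floorφ-injective {n} {i} {j} f f′ with <-cmp i j
... | tri< lt _ _ = contradiction (floorφ-mono-< f f′ lt) (<-irrefl refl)
... | tri≈ _ eq _ = eq
... | tri> _ _ gt = contradiction (floorφ-mono-< f′ f gt) (<-irrefl refl)

floorφ-zero : IsFloorφ 0 0
floorφ-zero = (λ ()) , s≤s z≤n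

-- Beatty's theorem for φ and φ² = φ + 1, in two halves.
beatty-disjoint : ∀ {s i k} → IsFloorφ s k → IsFloorφ (s + k) i → k ≡ 0
beatty-disjoint {k = zero} _ _ = refl
beatty-disjoint {zero} {k = k@(suc _)} (_ , gt) _ =
  contradiction (>φ·⇒> {1} {k} gt) λ { (s≤s ()) }
beatty-disjoint {s@(suc _)} {i} {k@(suc _)} (¬gt , gt) (¬gt′ , gt′)
  with φ-dichotomy s k z<s
... | inj₂ s>φk = contradiction s>φk ¬gt
... | inj₁ s<φk = contradiction s<i (<⇒≱ (s≤s i≤s))
  where
  -- Flipping s < φk < s + 1 gives φs < s + k and s + k + 1 < φ(s + 1). As φi lies between s + k and
  -- s + k + 1, this forces s < i < s + 1.
  s<i : s < i
  s<i = φ·-between (s + k) (flip-< {s} {k} s<φk) ¬gt′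
  i≤s : i ≤ s
  i≤s = s≤s⁻¹ (φ·-between (suc (s + k)) gt′ (<-asym (flip-> {suc s} {k} gt)))

beatty-cover : ∀ n → ∃ λ i → IsFloorφ n i ⊎ (∃ λ s → n ≡ s + i × IsFloorφ s i)
beatty-cover zero = 0 , inj₁ floorφ-zero
-- `s` is ⌊n/φ⌋, so that φs < n < φ(s + 1).
beatty-cover n@(suc _) with least (λ s → n * n <? suc s * suc s + n * suc s) n
    (<-≤-trans (*-mono-< (n<1+n n) (n<1+n n)) (m≤m+n _ _))
... | s , lt , min = cases (φ-dichotomy (suc n) (suc s) z<s)
  where
  n>φs : ∀ s → (∀ k → k < s → ¬ n <φ· suc k) → n >φ· s
  n>φs zero _ = subst (_< n * n) (sym (*-zeroʳ n)) z<s
  n>φs (suc s) min with φ-dichotomy n (suc s) z<s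
  ... | inj₁ lt = contradiction lt (min s ≤-refl)
  ... | inj₂ gt = gt
  cases : suc n <φ· suc s ⊎ suc n >φ· suc s → _
  -- If n + 1 exceeds φ(s + 1), then n = ⌊(s + 1)φ⌋. Otherwise put k = n - s: unflipping φs < n and
  -- n + 1 < φ(s + 1) gives s < φk < s + 1, so n = ⌊kφ⌋ + k.
  cases (inj₂ gt) = suc s , inj₁ (<-asym lt , gt)
  cases (inj₁ lt′)
    with k , s+k≡n ← m≤n⇒∃[o]m+o≡n (<⇒≤ (>φ·⇒> {n} {s} (n>φs s min))) =
    k , inj₂ (s , sym s+k≡n ,
      <-asym (unflip-> {s} {k} (subst (_>φ· s) (sym s+k≡n) (n>φs s min))) ,
      unflip-< {suc s} {k} (subst (λ n → suc n <φ· suc s) (sym s+k≡n) lt′))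

-- The pairs of `𝒫` and their coordinates

c : ℕ → ℕ
-- This value makes (0, 0) the pair of index 0, so that one formula covers all of `𝒫`.
c zero    = 0
c (suc i) = leastFresh (𝒫 i)

-- Membership in `𝒫 j` with the index exposed: moves between pairs are judged by their indices.
data Pair (j : ℕ) : Position → Set where
  lower : ∀ {i} → i ≤ j → Pair j (c i , c i + i)
  upper : ∀ {i} → i ≤ j → Pair j (c i + i , c i)

Pair-suc : ∀ {j s} → Pair j s → Pair (suc j) s
Pair-suc (lower i≤j) = lower (m≤n⇒m≤1+n i≤j)
Pair-suc (upper i≤j) = upper (m≤n⇒m≤1+n i≤j)

∈𝒫⇒Pair : ∀ j {s} → s ∈ 𝒫 j → Pair j s
∈𝒫⇒Pair zero    (here refl)         = lower z≤n
∈𝒫⇒Pair (suc j) (here refl)         = lower ≤-refl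
∈𝒫⇒Pair (suc j) (there (here refl)) = upper ≤-refl
∈𝒫⇒Pair (suc j) (there (there s∈))  = Pair-suc (∈𝒫⇒Pair j s∈)

Pair⇒∈𝒫 : ∀ j {s} → Pair j s → s ∈ 𝒫 j
Pair⇒∈𝒫 zero    (lower z≤n) = here refl
Pair⇒∈𝒫 zero    (upper z≤n) = here refl
Pair⇒∈𝒫 (suc j) (lower i≤1+j) with m≤n⇒m<n∨m≡n i≤1+j
... | inj₁ i<1+j = there (there (Pair⇒∈𝒫 j (lower (s≤s⁻¹ i<1+j))))
... | inj₂ refl  = here refl
Pair⇒∈𝒫 (suc j) (upper i≤1+j) with m≤n⇒m<n∨m≡n i≤1+j
... | inj₁ i<1+j = there (there (Pair⇒∈𝒫 j (upper (s≤s⁻¹ i<1+j))))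
... | inj₂ refl  = there (here refl)

∈coordinates⁻ : ∀ {n} ps → n ∈ coordinates ps →
                ∃ λ s → s ∈ ps × (n ≡ proj₁ s ⊎ n ≡ proj₂ s)
∈coordinates⁻ (s ∷ ps) (here refl)         = s , here refl , inj₁ refl
∈coordinates⁻ (s ∷ ps) (there (here refl)) = s , here refl , inj₂ refl
∈coordinates⁻ (s ∷ ps) (there (there n∈)) with t , t∈ , eq ← ∈coordinates⁻ ps n∈ =
  t , there t∈ , eq

∈coordinates⁺ : ∀ {s ps} → s ∈ ps → proj₁ s ∈ coordinates ps × proj₂ s ∈ coordinates ps
∈coordinates⁺ (here refl) = here refl , there (here refl)
∈coordinates⁺ (there s∈) with l , r ← ∈coordinates⁺ s∈ =
  there (there l) , there (there r)

isLeast-unique : ∀ {P : ℕ → Set} {m n} → IsLeast P m → IsLeast P n → m ≡ n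
isLeast-unique {m = m} {n} (Pm , minm) (Pn , minn) with <-cmp m n
... | tri< lt _ _ = contradiction Pm (minn m lt)
... | tri≈ _ eq _ = eq
... | tri> _ _ gt = contradiction Pn (minm n gt)

-- Freshness is the disjointness half of Beatty's theorem together with injectivity. Minimality is
-- the covering half: a smaller number belongs to a pair whose lower entry is below `n`, hence of
-- index at most `j`.
floorφ-isLeastFresh : ∀ j {n} → (∀ {i} → i ≤ j → IsFloorφ (c i) i) →
                      IsFloorφ n (suc j) → IsLeast (Fresh (𝒫 j)) n
floorφ-isLeastFresh j {n} fc fn = (0<n , n∉) , minimal
  where
  0<n : 0 < n
  0<n = ≤-<-trans z≤n (floorφ-mono-< floorφ-zero fn z<s)
  n≢c : ∀ {i} → i ≤ j → n ≢ c i
  n≢c i≤j refl = <⇒≢ (s≤s i≤j) (floorφ-injective (fc i≤j) fn)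
  n≢c+i : ∀ {i} → i ≤ j → n ≢ c i + i
  n≢c+i {i} i≤j refl with refl ← beatty-disjoint (fc i≤j) fn = <⇒≢ 0<n refl
  n∉ : n ∉ coordinates (𝒫 j)
  n∉ n∈ with ∈coordinates⁻ (𝒫 j) n∈
  ... | s , s∈ , eq with ∈𝒫⇒Pair j s∈ | eq
  ... | lower i≤j | inj₁ n≡ = n≢c i≤j n≡
  ... | lower i≤j | inj₂ n≡ = n≢c+i i≤j n≡
  ... | upper i≤j | inj₁ n≡ = n≢c+i i≤j n≡
  ... | upper i≤j | inj₂ n≡ = n≢c i≤j n≡
  c,c+i∈ : ∀ {i s} → IsFloorφ s i → s < n →
           s ∈ coordinates (𝒫 j) × s + i ∈ coordinates (𝒫 j)
  c,c+i∈ {i} fs s<n =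
    subst (λ s → s ∈ coordinates (𝒫 j) × s + i ∈ coordinates (𝒫 j))
      (floorφ-unique (fc i≤j) fs) (∈coordinates⁺ (Pair⇒∈𝒫 j (lower i≤j)))
    where i≤j = s≤s⁻¹ (floorφ-cancel-< fs fn s<n)
  minimal : ∀ k → k < n → ¬ Fresh (𝒫 j) k
  minimal k k<n (_ , k∉) with beatty-cover k
  ... | i , inj₁ fk              = k∉ (proj₁ (c,c+i∈ fk k<n))
  ... | i , inj₂ (s , refl , fs) = k∉ (proj₂ (c,c+i∈ fs (≤-<-trans (m≤m+n s i) k<n)))

-- Course-of-values induction, with `upTo b` covering all indices up to `b`: the floor and
-- `leastFresh` are both least fresh numbers, hence equal.
c-isFloorφ : ∀ j → IsFloorφ (c j) j
c-isFloorφ j = upTo j ≤-refl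
  where
  upTo : ∀ j {i} → i ≤ j → IsFloorφ (c i) i
  upTo _       {zero}  _         = floorφ-zero
  upTo (suc b) {suc j} (s≤s j≤b) = subst (λ n → IsFloorφ n (suc j))
    (isLeast-unique
      (floorφ-isLeastFresh j (λ i≤j → upTo b (≤-trans i≤j j≤b)) (proj₂ (floorφ-exists (suc j))))
      (leastFresh-isLeast (𝒫 j)))
    (proj₂ (floorφ-exists (suc j)))

c-mono-< : ∀ {i j} → i < j → c i < c j
c-mono-< {i} {j} = floorφ-mono-< (c-isFloorφ i) (c-isFloorφ j)

c-cancel-< : ∀ {i j} → c i < c j → i < j
c-cancel-< {i} {j} = floorφ-cancel-< (c-isFloorφ i) (c-isFloorφ j)

c-mono-≤ : ∀ {i j} → i ≤ j → c i ≤ c j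
c-mono-≤ i≤j = ≮⇒≥ λ lt → ≤⇒≯ i≤j (c-cancel-< lt)

c-injective : ∀ {i j} → c i ≡ c j → i ≡ j
c-injective {i} {j} eq =
  floorφ-injective (c-isFloorφ i) (subst (λ n → IsFloorφ n j) (sym eq) (c-isFloorφ j))

c+-injective : ∀ {i j} → c i + i ≡ c j + j → i ≡ j
c+-injective {i} {j} eq with <-cmp i j
... | tri< lt _ _ = contradiction eq (<⇒≢ (+-mono-< (c-mono-< lt) lt))
... | tri≈ _ i≡j _ = i≡j
... | tri> _ _ gt = contradiction eq (>⇒≢ (+-mono-< (c-mono-< gt) gt))

c≡c+⇒≡0 : ∀ {i k} → c i ≡ c k + k → k ≡ 0 × i ≡ 0
c≡c+⇒≡0 {i} {k} eq
  with refl ← beatty-disjoint (c-isFloorφ k) (subst (λ n → IsFloorφ n i) eq (c-isFloorφ i)) =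
  refl , c-injective eq

c-cover : ∀ n → ∃ λ i → n ≡ c i ⊎ n ≡ c i + i
c-cover n with beatty-cover n
... | i , inj₁ fn = i , inj₁ (floorφ-unique fn (c-isFloorφ i))
... | i , inj₂ (s , refl , fs) = i , inj₂ (cong (_+ i) (floorφ-unique fs (c-isFloorφ i)))

Pair-swap : ∀ {j} s → Pair j s → Pair j (swap s)
Pair-swap _ (lower i≤j) = upper i≤j
Pair-swap _ (upper i≤j) = lower i≤j

-- This excludes type I moves inside `𝒫 j`. Both sequences are injective, and they meet only at
-- index 0, where the two entries agree.
Pair-functional : ∀ {j p q r} → Pair j (p , q) → Pair j (p , r) → q ≡ r
Pair-functional {j} p∼q p∼r = unique p∼q p∼r refl
  where
  unique : ∀ {p p′ q r} → Pair j (p , q) → Pair j (p′ , r) → p ≡ p′ → q ≡ r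
  unique (lower {i} _) (lower {k} _) eq = cong (λ i → c i + i) (c-injective {i} {k} eq)
  unique (lower {i} _) (upper {k} _) eq with refl , refl ← c≡c+⇒≡0 {i} {k} eq = refl
  unique (upper {k} _) (lower {i} _) eq with refl , refl ← c≡c+⇒≡0 {i} {k} (sym eq) = refl
  unique (upper {i} _) (upper {k} _) eq = cong c (c+-injective {i} {k} eq)

-- The floor of m/φ expressed by natural numbers

module _ where
  private
    ι : ℕ → ℚ
    ι n = + n ℚ./ 1

    toℚᵘ-ι : ∀ n → ℚ.toℚᵘ (ι n) ℚᵘ.≃ mkℚᵘ (+ n) 0
    toℚᵘ-ι n = ℚₚ.toℚᵘ-fromℚᵘ (mkℚᵘ (+ n) 0)

    ι-+ : ∀ m n → ι (m + n) ≡ ι m ℚ.+ ι n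
    ι-+ m n = ℚₚ.toℚᵘ-injective (begin
      ℚ.toℚᵘ (ι (m + n))                   ≈⟨ toℚᵘ-ι (m + n) ⟩
      mkℚᵘ (+ (m + n)) 0                   ≈⟨ ℚᵘ.*≡* (cong (ℤ._* ℤ.1ℤ) (cong₂ ℤ._+_
                                                 (sym (ℤₚ.*-identityʳ (+ m)))
                                                 (sym (ℤₚ.*-identityʳ (+ n))))) ⟩
      mkℚᵘ (+ m) 0 ℚᵘ.+ mkℚᵘ (+ n) 0       ≈⟨ ℚᵘₚ.+-cong (toℚᵘ-ι m) (toℚᵘ-ι n) ⟨
      ℚ.toℚᵘ (ι m) ℚᵘ.+ ℚ.toℚᵘ (ι n)       ≈⟨ ℚₚ.toℚᵘ-homo-+ (ι m) (ι n) ⟨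
      ℚ.toℚᵘ (ι m ℚ.+ ι n)                 ∎)
      where open ℚᵘₚ.≃-Reasoning

    ι-* : ∀ m n → ι (m * n) ≡ ι m ℚ.* ι n
    ι-* m n = ℚₚ.toℚᵘ-injective (begin
      ℚ.toℚᵘ (ι (m * n))                   ≈⟨ toℚᵘ-ι (m * n) ⟩
      mkℚᵘ (+ (m * n)) 0                   ≈⟨ ℚᵘ.*≡* (cong (ℤ._* ℤ.1ℤ) (ℤₚ.pos-* m n)) ⟩
      mkℚᵘ (+ m) 0 ℚᵘ.* mkℚᵘ (+ n) 0       ≈⟨ ℚᵘₚ.*-cong (toℚᵘ-ι m) (toℚᵘ-ι n) ⟨
      ℚ.toℚᵘ (ι m) ℚᵘ.* ℚ.toℚᵘ (ι n)       ≈⟨ ℚₚ.toℚᵘ-homo-* (ι m) (ι n) ⟨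
      ℚ.toℚᵘ (ι m ℚ.* ι n)                 ∎)
      where open ℚᵘₚ.≃-Reasoning

    ι-mono-≤ : ∀ {m n} → m ≤ n → ι m ℚ.≤ ι n
    ι-mono-≤ {m} {n} m≤n = ℚₚ.toℚᵘ-cancel-≤
      (ℚᵘₚ.≤-respˡ-≃ (ℚᵘₚ.≃-sym (toℚᵘ-ι m)) (ℚᵘₚ.≤-respʳ-≃ (ℚᵘₚ.≃-sym (toℚᵘ-ι n))
        (ℚᵘ.*≤* (ℤₚ.*-monoʳ-≤-nonNeg (+ 1) (ℤ.+≤+ m≤n)))))

    ι-cancel-≤ : ∀ {m n} → ι m ℚ.≤ ι n → m ≤ n
    ι-cancel-≤ {m} {n} le
      with ℚᵘₚ.≤-respˡ-≃ (toℚᵘ-ι m) (ℚᵘₚ.≤-respʳ-≃ (toℚᵘ-ι n) (ℚₚ.toℚᵘ-mono-≤ le))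
    ... | ℚᵘ.*≤* le′ =
      ℤ.drop‿+≤+ (subst₂ ℤ._≤_ (ℤₚ.*-identityʳ (+ m)) (ℤₚ.*-identityʳ (+ n)) le′)

    0≤ι : ∀ n → 0ℚ ℚ.≤ ι n
    0≤ι n = ι-mono-≤ {0} {n} z≤n

    open ≡-Reasoning
    open +-*-Solver using (solve; con; _:+_; _:*_; _:-_; :-_; _:=_)

    0≤q-p⇒p≤q : ∀ {p q} → 0ℚ ℚ.≤ q ℚ.- p → p ℚ.≤ q
    0≤q-p⇒p≤q {p} {q} le = subst₂ ℚ._≤_ (ℚₚ.+-identityˡ p)
      (solve 2 (λ p q → (q :- p) :+ p := q) refl p q) (ℚₚ.+-monoˡ-≤ p le)

    p≤q⇒0≤q-p : ∀ {p q} → p ℚ.≤ q → 0ℚ ℚ.≤ q ℚ.- p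
    p≤q⇒0≤q-p {p} {q} le = subst (ℚ._≤ q ℚ.- p) (ℚₚ.+-inverseʳ p) (ℚₚ.+-monoˡ-≤ (ℚ.- p) le)

    module _ (m n : ℕ) where
      M N rat irr : ℚ
      M = ι m
      N = ι n
      rat = M ℚ.* -½ ℚ.+ 5ℚ ℚ.* (0ℚ ℚ.* ½) ℚ.- N
      irr = M ℚ.* ½ ℚ.+ 0ℚ ℚ.* -½ ℚ.- 0ℚ

      ∣rat∣ : ℚ.∣ rat ∣ ≡ ½ ℚ.* M ℚ.+ N
      ∣rat∣ = begin
        ℚ.∣ rat ∣                  ≡⟨ cong ℚ.∣_∣ (solve 2 (λ x y →
                                       x :* con -½ :+ con 5ℚ :* (con 0ℚ :* con ½) :- y
                                         := :- (con ½ :* x :+ y)) refl M N) ⟩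
        ℚ.∣ ℚ.- (½ ℚ.* M ℚ.+ N) ∣  ≡⟨ ℚₚ.∣-p∣≡∣p∣ (½ ℚ.* M ℚ.+ N) ⟩
        ℚ.∣ ½ ℚ.* M ℚ.+ N ∣
          ≡⟨ ℚₚ.0≤p⇒∣p∣≡p (ℚₚ.+-mono-≤ {0ℚ} (ℚₚ.*-monoˡ-≤-nonNeg ½ (0≤ι m)) (0≤ι n)) ⟩
        ½ ℚ.* M ℚ.+ N              ∎

      ∣irr∣ : ℚ.∣ irr ∣ ≡ ½ ℚ.* M
      ∣irr∣ = begin
        ℚ.∣ irr ∣      ≡⟨ cong ℚ.∣_∣ (solve 1 (λ x →
                           x :* con ½ :+ con 0ℚ :* con -½ :- con 0ℚ := con ½ :* x) refl M) ⟩
        ℚ.∣ ½ ℚ.* M ∣  ≡⟨ ℚₚ.0≤p⇒∣p∣≡p (ℚₚ.*-monoˡ-≤-nonNeg ½ (0≤ι m)) ⟩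
        ½ ℚ.* M        ∎

      -- m/φ - n is -(m/2 + n) + (m/2)√5. With the signs of both parts known, the signed squares add
      -- up to 5(m/2)² - (m/2 + n)² = m² - mn - n².
      norm≡ : rat ℚ.* ℚ.∣ rat ∣ ℚ.+ 5ℚ ℚ.* (irr ℚ.* ℚ.∣ irr ∣) ≡
              ι (m * m) ℚ.- ι (n * n + m * n)
      norm≡ = begin
        rat ℚ.* ℚ.∣ rat ∣ ℚ.+ 5ℚ ℚ.* (irr ℚ.* ℚ.∣ irr ∣)
          ≡⟨ cong₂ (λ x y → rat ℚ.* x ℚ.+ 5ℚ ℚ.* (irr ℚ.* y)) ∣rat∣ ∣irr∣ ⟩
        rat ℚ.* (½ ℚ.* M ℚ.+ N) ℚ.+ 5ℚ ℚ.* (irr ℚ.* (½ ℚ.* M))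
          ≡⟨ solve 2 (λ x y →
               (x :* con -½ :+ con 5ℚ :* (con 0ℚ :* con ½) :- y) :* (con ½ :* x :+ y)
                 :+ con 5ℚ :* ((x :* con ½ :+ con 0ℚ :* con -½ :- con 0ℚ) :* (con ½ :* x))
               := x :* x :- (y :* y :+ x :* y)) refl M N ⟩
        M ℚ.* M ℚ.- (N ℚ.* N ℚ.+ M ℚ.* N)
          ≡⟨ cong₂ ℚ._-_ (ι-* m m) (trans (ι-+ (n * n) (m * n)) (cong₂ ℚ._+_ (ι-* n n) (ι-* m n))) ⟨
        ι (m * m) ℚ.- ι (n * n + m * n) ∎

  ≤√/φ⇒ : ∀ m n → fromℕ n ≤√ (m /φ) → n * n + m * n ≤ m * m
  ≤√/φ⇒ m n le = ι-cancel-≤ (0≤q-p⇒p≤q (subst (0ℚ ℚ.≤_) (norm≡ m n) le))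

  ≤√/φ⇐ : ∀ m n → n * n + m * n ≤ m * m → fromℕ n ≤√ (m /φ)
  ≤√/φ⇐ m n le = subst (0ℚ ℚ.≤_) (sym (norm≡ m n)) (p≤q⇒0≤q-p (ι-mono-≤ le))

m<φ·1+a : ∀ m → m <φ· suc (a m)
m<φ·1+a m = ≰⇒> λ le → proj₂ (a-isFloor m) (≤√/φ⇐ m (suc (a m)) le)

-- The floor yields only a weak inequality; irrationality of φ makes it strict for positive `m`.
m>φ·a : ∀ m .{{_ : NonZero m}} → m >φ· a m
m>φ·a m = ≤∧≢⇒< (≤√/φ⇒ m (a m) (proj₁ (a-isFloor m)))
  λ eq → ≢-nonZero⁻¹ m (φ-irrational m (a m) (sym eq))

-- Moves in terms of their end points

∣∸-∸∣ : ∀ {p q r s} → r ≤ p → s ≤ q → ∣ p ∸ r - q ∸ s ∣ ≡ ∣ p + s - q + r ∣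
-- With p = r + k and q = s + l, both sides equal the distance of k and l.
∣∸-∸∣ {r = r} {s} r≤p s≤q
  with k , refl ← m≤n⇒∃[o]m+o≡n r≤p | l , refl ← m≤n⇒∃[o]m+o≡n s≤q = begin
  ∣ r + k ∸ r - s + l ∸ s ∣      ≡⟨ cong₂ ∣_-_∣ (m+n∸m≡n r k) (m+n∸m≡n s l) ⟩
  ∣ k - l ∣                      ≡⟨ ∣m+n-m+o∣≡∣n-o∣ (r + s) k l ⟨
  ∣ r + s + k - r + s + l ∣      ≡⟨ cong₂ ∣_-_∣ (left r s k) (right r s l) ⟩
  ∣ r + k + s - s + l + r ∣      ∎
  where
  open ≡-Reasoning
  left : ∀ r s k → r + s + k ≡ r + k + s
  left = solve-∀
  right : ∀ r s l → r + s + l ≡ s + l + r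
  right = solve-∀

module _ {m : ℕ} where

  -- Moves described by their end points; the congruence p - r ≡ q - s is
  -- rearranged to avoid subtraction.
  data Step : Position → Position → Set where
    first  : ∀ {p q r} → r < p → Step (p , q) (r , q)
    second : ∀ {p q s} → s < q → Step (p , q) (p , s)
    both   : ∀ {p q r s} → r < p → s < q → (p + s) ≡ (q + r) [mod m ] →
             Step (p , q) (r , s)

  Step⇒Move : ∀ {x y} → Step x y → Move m x y
  Step⇒Move (first {p} {q} {r} r<p) =
    subst (λ r → Move m _ (r , q)) (m∸[m∸n]≡n (<⇒≤ r<p))
      (take₁ (p ∸ r) (m<n⇒0<n∸m r<p) (m∸n≤m p r))
  Step⇒Move (second {p} {q} {s} s<q) =
    subst (λ s → Move m _ (p , s)) (m∸[m∸n]≡n (<⇒≤ s<q))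
      (take₂ (q ∸ s) (m<n⇒0<n∸m s<q) (m∸n≤m q s))
  Step⇒Move (both {p} {q} {r} {s} r<p s<q p+s≡q+r) =
    subst₂ (λ r s → Move m _ (r , s)) (m∸[m∸n]≡n (<⇒≤ r<p)) (m∸[m∸n]≡n (<⇒≤ s<q))
      (takeBoth (p ∸ r) (q ∸ s) (m<n⇒0<n∸m r<p) (m∸n≤m p r) (m<n⇒0<n∸m s<q) (m∸n≤m q s)
        (subst (m ∣_) (sym (∣∸-∸∣ (<⇒≤ r<p) (<⇒≤ s<q))) p+s≡q+r))

  Move⇒Step : ∀ {x y} → Move m x y → Step x y
  Move⇒Step (take₁ k 0<k k≤p) = first (∸-monoʳ-< 0<k k≤p)
  Move⇒Step (take₂ k 0<k k≤q) = second (∸-monoʳ-< 0<k k≤q)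
  Move⇒Step (takeBoth {p} {q} k l 0<k k≤p 0<l l≤q k≡l) =
    both (∸-monoʳ-< 0<k k≤p) (∸-monoʳ-< 0<l l≤q)
      (subst (m ∣_) (trans (cong₂ ∣_-_∣ (sym (m∸[m∸n]≡n k≤p)) (sym (m∸[m∸n]≡n l≤q)))
                           (∣∸-∸∣ (m∸n≤m p k) (m∸n≤m q l))) k≡l)

  Step-swap : ∀ {x y} → Step x y → Step (swap x) (swap y)
  Step-swap (first r<p) = second r<p
  Step-swap (second s<q) = first s<q
  Step-swap (both {p} {q} {r} {s} r<p s<q p+s≡q+r) =
    both s<q r<p (subst (m ∣_) (∣-∣-comm (p + s) (q + r)) p+s≡q+r)

  size : Position → ℕ
  size (p , q) = p + q

  Step-decreasing : ∀ {x y} → Step x y → size y < size x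
  Step-decreasing (first {q = q} r<p)  = +-monoˡ-< q r<p
  Step-decreasing (second {p} s<q) = +-monoʳ-< p s<q
  Step-decreasing (both r<p s<q _) = +-mono-< r<p s<q

  PPosition⇒¬NPosition : ∀ {x} → PPosition m x → ¬ NPosition m x
  PPosition⇒¬NPosition (allMovesToN toN) (someMoveToP y x→y yP) =
    PPosition⇒¬NPosition yP (toN y x→y)

-- P-positions, given φA < m < φ(A + 1)

module _ (m A : ℕ) .{{_ : NonZero m}} (m>φA : m >φ· A) (m<φ1+A : m <φ· suc A) where

  A<m : A < m
  A<m = >φ·⇒> {m} {A} m>φA

  c[A]<m : c A < m
  c[A]<m = ≰⇒> λ m≤cA → IsFloorφ.below (c-isFloorφ A) (>φ·-monoˡ {y = A} m≤cA m>φA)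

  m≤c[1+A] : m ≤ c (suc A)
  m≤c[1+A] = ≮⇒≥ λ lt → <-asym m<φ1+A
    (>φ·-monoˡ {y = suc A} lt (IsFloorφ.above (c-isFloorφ (suc A))))

  c<m⇒≤A : ∀ {i} → c i < m → i ≤ A
  c<m⇒≤A ci<m = s≤s⁻¹ (c-cancel-< (<-≤-trans ci<m m≤c[1+A]))

  -- Of the positive numbers below m, A are of the form c i, hence m - 1 - A are
  -- of the form c j + j.
  +A<m⇒c+<m : ∀ {j} → j + A < m → c j + j < m
  +A<m⇒c+<m {j} j+A<m with e , j+A+e≡m ← m≤n⇒∃[o]m+o≡n j+A<m =
    ≤-<-trans (≤-trans (+-monoˡ-≤ j cj≤A) (≤-reflexive (+-comm A j))) j+A<m
    where
    regroup : ∀ a j e → suc (j + a) + e ≡ suc a + (j + e)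
    regroup = solve-∀
    -- Here m = (A + 1) + (j + e), so m < φ(A + 1) unflips to φ(j + e) < A + 1.
    1+A>φj : suc A >φ· j
    1+A>φj = >φ·-antiʳ (suc A) (m≤m+n j e) (unflip-< {suc A} {j + e}
      (subst (_<φ· suc A) (trans (sym j+A+e≡m) (regroup A j e)) m<φ1+A))
    cj≤A : c j ≤ A
    cj≤A = ≮⇒≥ λ lt → IsFloorφ.below (c-isFloorφ j) (>φ·-monoˡ {y = j} lt 1+A>φj)

  -- If j ≥ m - A, then m > φA unflips to A < φ(m - A) ≤ φj. Hence A ≤ `c j`, and `c j + j` is at
  -- least m.
  c+<m⇒+A<m : ∀ {j} → c j + j < m → j + A < m
  c+<m⇒+A<m {j} cj+j<m with k , A+k≡m ← m≤n⇒∃[o]m+o≡n (<⇒≤ A<m) = ≰⇒> λ m≤j+A →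
    let k≤j = +-cancelˡ-≤ A k j (subst₂ _≤_ (sym A+k≡m) (+-comm j A) m≤j+A)
        A<φj = <φ·-monoʳ A k≤j (unflip-> {A} {k} (subst (_>φ· A) (sym A+k≡m) m>φA))
        A≤cj = ≮⇒≥ λ lt → <-asym A<φj
                 (>φ·-monoˡ {y = j} lt (IsFloorφ.above (c-isFloorφ j)))
    in <⇒≱ cj+j<m (≤-trans m≤j+A (≤-trans (≤-reflexive (+-comm j A)) (+-monoˡ-≤ j A≤cj)))

  ¬both-lower : ∀ {i r s} → i ≤ A → Pair A (r , s) → r < c i →
                ¬ (c i + s) ≡ (c i + i + r) [mod m ]
  ¬both-lower {i} i≤A (lower {j} _) cj<ci m∣
    with e , refl ← m≤n⇒∃[o]m+o≡n (c-cancel-< {j} {i} cj<ci) =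
    -- The congruence makes `m` divide i - j = `suc e`, which is at most `i` and so below `m`.
    >⇒∤ (≤-<-trans (s≤s (m≤n+m e j)) (≤-<-trans i≤A A<m)) (subst (m ∣_) distance m∣)
    where
    open ≡-Reasoning
    left : ∀ x y j → x + (y + j) ≡ x + y + j + 0
    left = solve-∀
    right : ∀ x y j e → x + suc (j + e) + y ≡ x + y + j + suc e
    right = solve-∀
    distance : ∣ c i + (c j + j) - c i + i + c j ∣ ≡ suc e
    distance = begin
      ∣ c i + (c j + j) - c i + i + c j ∣
        ≡⟨ cong₂ ∣_-_∣ (left (c i) (c j) j) (right (c i) (c j) j e) ⟩
      ∣ c i + c j + j + 0 - c i + c j + j + suc e ∣
        ≡⟨ ∣m+n-m+o∣≡∣n-o∣ (c i + c j + j) 0 (suc e) ⟩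
      suc e                                            ∎
  -- No number is below `c 0`, so `i` is positive; this also makes `i + j` nonzero, as `>⇒∤`
  -- requires.
  ¬both-lower {i@(suc _)} i≤A (upper {j} _) cj+j<ci m∣ =
    >⇒∤ i+j<m (subst (m ∣_) distance m∣)
    where
    open ≡-Reasoning
    i+j<m : i + j < m
    i+j<m = ≤-<-trans (≤-trans (+-monoˡ-≤ j i≤A) (≤-reflexive (+-comm A j)))
              (c+<m⇒+A<m (<-trans (<-≤-trans cj+j<ci (c-mono-≤ i≤A)) c[A]<m))
    right : ∀ x y i j → x + i + (y + j) ≡ x + y + (i + j)
    right = solve-∀
    distance : ∣ c i + c j - c i + i + (c j + j) ∣ ≡ i + j
    distance = begin
      ∣ c i + c j - c i + i + (c j + j) ∣    ≡⟨ cong ∣ c i + c j -_∣ (right (c i) (c j) i j) ⟩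
      ∣ c i + c j - c i + c j + (i + j) ∣    ≡⟨ ∣m-m+n∣≡n (c i + c j) (i + j) ⟩
      i + j                                  ∎

  -- A type I move would place one number in two pairs. The type II case starting from `upper` is
  -- the `lower` one with the piles exchanged.
  noStep : ∀ {x y} → Pair A x → Pair A y → ¬ Step {m} x y
  noStep x∈ y∈ (second s<q) = <⇒≢ s<q (Pair-functional y∈ x∈)
  noStep x∈ y∈ (first r<p) = <⇒≢ r<p (Pair-functional (Pair-swap _ y∈) (Pair-swap _ x∈))
  noStep (lower i≤A) y∈ (both r<p _ eq) = ¬both-lower i≤A y∈ r<p eq
  noStep (upper i≤A) y∈ (both {p} {q} {r} {s} _ s<q eq) =
    ¬both-lower i≤A (Pair-swap _ y∈) s<q (subst (m ∣_) (∣-∣-comm (p + s) (q + r)) eq)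

  -- Moves into `𝒫 A` from outside

  CanReach : Position → Set
  CanReach x = Pair A x ⊎ ∃ λ y → Pair A y × Step {m} x y

  reach-large : ∀ p d → m ≤ p → CanReach (p , p + d)
  reach-large p d m≤p with d % m ≤? A
  ... | yes r≤A = inj₂ (_ , lower {i = d % m} r≤A , both cr<p
          (+-mono-<-≤ cr<p (m%n≤m d m)) (divides (d / m) distance))
    where
    open ≡-Reasoning
    r = d % m
    cr<p : c r < p
    cr<p = <-≤-trans (≤-<-trans (c-mono-≤ r≤A) c[A]<m) m≤p
    left : ∀ p x r → p + (x + r) ≡ p + x + r + 0
    left = solve-∀
    right : ∀ p x r k → p + (r + k) + x ≡ p + x + r + k
    right = solve-∀
    distance : ∣ p + (c r + r) - p + d + c r ∣ ≡ d / m * m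
    distance = begin
      ∣ p + (c r + r) - p + d + c r ∣
        ≡⟨ cong (λ d → ∣ p + (c r + r) - p + d + c r ∣) (m≡m%n+[m/n]*n d m) ⟩
      ∣ p + (c r + r) - p + (r + d / m * m) + c r ∣
        ≡⟨ cong₂ ∣_-_∣ (left p (c r) r) (right p (c r) r (d / m * m)) ⟩
      ∣ p + c r + r + 0 - p + c r + r + d / m * m ∣
        ≡⟨ ∣m+n-m+o∣≡∣n-o∣ (p + c r + r) 0 (d / m * m) ⟩
      d / m * m                                             ∎
  -- i = m - r. The reversed pair of index i has signed difference -i, congruent to r. From r > A
  -- follows i + A < m, so both its entries are below m and its index is at most A.
  ... | no r≰A with i , r+i≡m ← m≤n⇒∃[o]m+o≡n (<⇒≤ (m%n<n d m)) =
          inj₂ (_ , upper {i = i} (c<m⇒≤A (≤-<-trans (m≤m+n (c i) i) ci+i<m)) ,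
            both (<-≤-trans ci+i<m m≤p)
              (<-≤-trans (≤-<-trans (m≤m+n (c i) i) ci+i<m) (≤-trans m≤p (m≤m+n p d)))
              (divides (suc (d / m)) distance))
    where
    open ≡-Reasoning
    r = d % m
    ci+i<m : c i + i < m
    ci+i<m = +A<m⇒c+<m (subst₂ _<_ (+-comm A i) r+i≡m (+-monoˡ-< i (≰⇒> r≰A)))
    right : ∀ p x r k i → p + (r + k) + (x + i) ≡ p + x + ((r + i) + k)
    right = solve-∀
    distance : ∣ p + c i - p + d + (c i + i) ∣ ≡ suc (d / m) * m
    distance = begin
      ∣ p + c i - p + d + (c i + i) ∣
        ≡⟨ cong (λ d → ∣ p + c i - p + d + (c i + i) ∣) (m≡m%n+[m/n]*n d m) ⟩
      ∣ p + c i - p + (r + d / m * m) + (c i + i) ∣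
        ≡⟨ cong ∣ p + c i -_∣ (right p (c i) r (d / m * m) i) ⟩
      ∣ p + c i - p + c i + (r + i + d / m * m) ∣           ≡⟨ ∣m-m+n∣≡n (p + c i) _ ⟩
      r + i + d / m * m                                     ≡⟨ cong (_+ d / m * m) r+i≡m ⟩
      suc (d / m) * m                                       ∎

  reach-lower : ∀ i q → i ≤ A → c i ≤ q → CanReach (c i , q)
  reach-lower i q i≤A ci≤q with <-cmp q (c i + i)
  ... | tri≈ _ refl _ = inj₁ (lower {i = i} i≤A)
  ... | tri> _ _ gt = inj₂ (_ , lower {i = i} i≤A , second gt)
  -- q = `c i + j` with j < i, so removing equal amounts leads to the pair of index j, as in
  -- Wythoff's game.
  ... | tri< lt _ _ with j , refl ← m≤n⇒∃[o]m+o≡n ci≤q =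
    inj₂ (_ , lower {i = j} (≤-trans (<⇒≤ j<i) i≤A) , both (c-mono-< j<i) (+-monoˡ-< j (c-mono-< j<i))
      (subst (m ∣_) (sym (m≡n⇒∣m-n∣≡0 (same (c i) (c j) j))) (m ∣0)))
    where
    j<i : j < i
    j<i = +-cancelˡ-< (c i) j i lt
    same : ∀ x y j → x + (y + j) ≡ x + j + y
    same = solve-∀

  reach-upper : ∀ i q → i ≤ A → c i + i ≤ q → CanReach (c i + i , q)
  reach-upper i q i≤A ci+i≤q with m≤n⇒m<n∨m≡n (≤-trans (m≤m+n (c i) i) ci+i≤q)
  ... | inj₁ ci<q = inj₂ (_ , upper i≤A , second ci<q)
  ... | inj₂ refl = inj₁ (upper i≤A)

  reach-≤ : ∀ p q → p ≤ q → CanReach (p , q)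
  reach-≤ p q p≤q with c-cover p
  ... | i , p≡ with i ≤? A | p≡
  ... | yes i≤A | inj₁ refl = reach-lower i q i≤A p≤q
  ... | yes i≤A | inj₂ refl = reach-upper i q i≤A p≤q
  -- An index above A means `c i` is at least m, hence so is p, whichever sequence it belongs to.
  ... | no i≰A | _ with d , refl ← m≤n⇒∃[o]m+o≡n p≤q =
    reach-large p d (≤-trans (≮⇒≥ λ ci<m → i≰A (c<m⇒≤A ci<m)) (ci≤p p≡))
    where
    ci≤p : p ≡ c i ⊎ p ≡ c i + i → c i ≤ p
    ci≤p (inj₁ refl) = ≤-refl
    ci≤p (inj₂ refl) = m≤m+n (c i) i

  reach : ∀ x → CanReach x
  reach (p , q) with ≤-total p q
  ... | inj₁ p≤q = reach-≤ p q p≤q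
  ... | inj₂ q≤p with reach-≤ q p q≤p
  ... | inj₁ x∈ = inj₁ (Pair-swap _ x∈)
  ... | inj₂ (y , y∈ , x→y) = inj₂ (swap y , Pair-swap _ y∈ , Step-swap x→y)

  -- Every move leaves `𝒫 A` by `noStep`, and `reach` answers with a move back into it; the
  -- recursion is on the total number of tokens.
  Pair⇒PPosition : ∀ {x} → Acc _<_ (size {m} x) → Pair A x → PPosition m x
  Pair⇒PPosition (acc rec) x∈ = allMovesToN λ y x→y → toN y (Move⇒Step x→y) (reach y)
    where
    toN : ∀ y → Step _ y → CanReach y → NPosition m y
    toN y x→y (inj₁ y∈) = contradiction x→y (noStep x∈ y∈)
    toN y x→y (inj₂ (z , z∈ , y→z)) = someMoveToP z (Step⇒Move y→z)
      (Pair⇒PPosition (rec (<-trans (Step-decreasing y→z) (Step-decreasing x→y))) z∈)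

  -- Outside `𝒫 A`, `reach` supplies a move to a P-position, so the position would be an N-position
  -- as well.
  PPosition⇒Pair : ∀ {x} → PPosition m x → Pair A x
  PPosition⇒Pair {x} xP with reach x
  ... | inj₁ x∈ = x∈
  ... | inj₂ (y , y∈ , x→y) = contradiction
    (someMoveToP y (Step⇒Move x→y) (Pair⇒PPosition (<-wellFounded _) y∈))
    (PPosition⇒¬NPosition xP)

theorem5 : (m : ℕ) .{{_ : NonZero m}} → PPosition m ≐ (_∈ 𝒫 (a m))
theorem5 m =
  (λ xP → Pair⇒∈𝒫 (a m) (PPosition⇒Pair m (a m) (m>φ·a m) (m<φ·1+a m) xP)) ,
  (λ x∈ → Pair⇒PPosition m (a m) (m>φ·a m) (m<φ·1+a m) (<-wellFounded _) (∈𝒫⇒Pair (a m) x∈))
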